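{- (Induction Lemma) Let $A$ be a finite set, $\ell$ a positive integer, and let $P\subseteq B_\ell(A)$ be such that $CP(k+1,P)\subseteq\lceil CP(k,P)\rceil$ for some $k\in\mathbb N$. Then $\lceil CP(m,P)\rceil\subseteq\lceil CP(n,P)\rceil$ for all $m\ge n\ge k$.
   Context: $\mathbb N$ includes $0$. For a finite set $A$ and a positive integer $n$, $B_n(A)=\mathrm{Sym}(A^n)$ is the group of bijections $A^n\to A^n$ and $B(A)=\bigcup_n B_n(A)$; its elements are called gates. For $\alpha\in S_n$, the wire permutation is $\pi_\alpha(x_1,\dots,x_n)=(x_{\alpha^{ -1}(1)},\dots,x_{\alpha^{ -1}(n)})$; a rewiring of $f\in B_n(A)$ is $\pi_\alpha\circ f\circ\pi_\alpha^{ -1}$ for some $\alpha\in S_n$. For $f\in B_n(A)$, $g\in B_m(A)$, $f\oplus g\in B_{n+m}(A)$ applies $f$ to the first $n$ coordinates and $g$ to the last $m$; $\mathrm{id}_k$ is the identity of $A^k$. The extensions of $f\in B_\ell(A)$ on $A^n$, $n\ge\ell$, are the rewirings of $f\oplus \mathrm{id}_{n-\ell}$. For $P\subseteq B(A)$, $\lceil P\rceil\subseteq B(A)$ is the set of all gates obtained from $\mathrm{id}_1$ and the elements of $P$ by compositions of gates of equal arity and extensions. For $k\in\mathbb N$, $w\in A^k$ and $p\in B_\ell(A)$, the gate $f_{w,p}\in B_{k+\ell}(A)$ is defined for $u\in A^k$, $v\in A^\ell$ by $f_{w,p}(uv)=u\,p(v)$ if $u=w$ and $f_{w,p}(uv)=uv$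 if $u\ne w$. For $P\subseteq B_\ell(A)$, $CP(k,P)\subseteq B_{k+\ell}(A)$ is the set of all rewirings of the gates $f_{w,p}$ with $w\in A^k$, $p\in P$. -}

module Defs where

open import Level using (Level; _⊔_)
open import Data.Bool.Base using (if_then_else_)
open import Data.Fin.Base using (Fin)
import Data.Fin.Properties as Fin
open import Data.Fin.Permutation using (Permutation′; _⟨$⟩ˡ_; flip; inverseˡ; inverseʳ)
open import Data.Nat.Base using (ℕ; _+_)
open import Data.Product.Base using (Σ; ∃-syntax; _×_; _,_)
open import Data.Vec.Base using (Vec; _++_; take; drop; lookup; tabulate)
open import Data.Vec.Properties
  using (≡-dec; take++drop≡id; ++-injectiveˡ; ++-injectiveʳ; lookup∘tabulate; tabulate∘lookup; tabulate-cong)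
open import Function.Bundles using (_↔_; Inverse; mk↔ₛ′)
open import Function.Construct.Composition using (_↔-∘_)
open import Function.Construct.Identity using (↔-id)
open import Function.Construct.Symmetry using (↔-sym)
open import Function.Properties.Inverse using (↔⇒↣)
open import Relation.Binary.Definitions using (DecidableEquality)
open import Relation.Binary.PropositionalEquality
  using (_≡_; _≢_; _≗_; refl; trans; cong; cong₂)
open import Relation.Nullary using (yes; no)
open import Relation.Nullary.Negation using (contradiction)
open import Relation.Nullary.Decidable using (does; via-injection)
open import Relation.Unary using (Pred; _∈_)

private
  variable
    a p : Level
    A : Set a
    k ℓ m n : ℕ

Finite : Set a → Set a
Finite A = ∃[ q ] (A ↔ Fin q)

Finite⇒≟ : Finite A → DecidableEquality A
Finite⇒≟ (_ , A↔Fin) = via-injection (↔⇒↣ A↔Fin) Fin._≟_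

take-++ : ∀ (u : Vec A m) (v : Vec A n) → take m (u ++ v) ≡ u
take-++ {m = m} u v = ++-injectiveˡ (take m (u ++ v)) u (take++drop≡id m (u ++ v))

drop-++ : ∀ (u : Vec A m) (v : Vec A n) → drop m (u ++ v) ≡ v
drop-++ {m = m} u v = ++-injectiveʳ (take m (u ++ v)) u (take++drop≡id m (u ++ v))

-- The group Bₙ(A).  Arity 0 is included so that _⊕_ can be used with the
-- identity of A⁰.
Gate : Set a → ℕ → Set a
Gate A n = Vec A n ↔ Vec A n

-- Gates are equal when they are equal as functions; _≡_ on Gate would also
-- compare the stored inverses and proofs.
infix 4 _≈_
_≈_ : {A : Set a} → Gate A n → Gate A n → Set a
f ≈ g = Inverse.to f ≗ Inverse.to g

idGate : ∀ n → Gate A n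
idGate {A = A} n = ↔-id (Vec A n)

infixr 9 _∘ᵍ_
_∘ᵍ_ : Gate A n → Gate A n → Gate A n
f ∘ᵍ g = f ↔-∘ g

permute : Permutation′ n → Vec A n → Vec A n
permute α x = tabulate (λ i → lookup x (α ⟨$⟩ˡ i))

permute-inverse : ∀ (α β : Permutation′ n) → (∀ i → β ⟨$⟩ˡ (α ⟨$⟩ˡ i) ≡ i) →
                  ∀ (x : Vec A n) → permute α (permute β x) ≡ x
permute-inverse α β eq x = trans
  (tabulate-cong λ i → trans (lookup∘tabulate _ (α ⟨$⟩ˡ i)) (cong (lookup x) (eq i)))
  (tabulate∘lookup x)

wire : Permutation′ n → Gate A n
wire α = mk↔ₛ′ (permute α) (permute (flip α))
  (permute-inverse α (flip α) (λ _ → inverseʳ α))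
  (permute-inverse (flip α) α (λ _ → inverseˡ α))

rewire : Permutation′ n → Gate A n → Gate A n
rewire α f = wire α ∘ᵍ f ∘ᵍ ↔-sym (wire α)

parallel : (Vec A n → Vec A n) → (Vec A m → Vec A m) → Vec A (n + m) → Vec A (n + m)
parallel {n = n} s t x = s (take n x) ++ t (drop n x)

parallel-inverse : ∀ (s s′ : Vec A n → Vec A n) (t t′ : Vec A m → Vec A m) →
                   (∀ u → s (s′ u) ≡ u) → (∀ v → t (t′ v) ≡ v) →
                   ∀ x → parallel s t (parallel s′ t′ x) ≡ x
parallel-inverse {n = n} s s′ t t′ ss′ tt′ x = trans
  (cong₂ _++_
    (trans (cong s (take-++ (s′ (take n x)) (t′ (drop n x)))) (ss′ (take n x)))
    (trans (cong t (drop-++ (s′ (take n x)) (t′ (drop n x)))) (tt′ (drop n x))))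
  (take++drop≡id n x)

infixr 6 _⊕_
_⊕_ : Gate A n → Gate A m → Gate A (n + m)
f ⊕ g = mk↔ₛ′ (parallel F.to G.to) (parallel F.from G.from)
  (parallel-inverse F.to F.from G.to G.from F.strictlyInverseˡ G.strictlyInverseˡ)
  (parallel-inverse F.from F.to G.from G.to F.strictlyInverseʳ G.strictlyInverseʳ)
  where
  module F = Inverse f
  module G = Inverse g

-- B(A), the disjoint union of the Bₙ(A).
B : Set a → Set a
B A = Σ ℕ (Gate A)

-- A set of gates of a fixed arity, viewed as a subset of B(A).
data inB {A : Set a} {n : ℕ} (P : Pred (Gate A n) p) : Pred (B A) (a ⊔ p) where
  gate : ∀ {f} → f ∈ P → (n , f) ∈ inB P

-- An extension of f : Gate A n to arity N ≥ n is a rewiring of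
-- f ⊕ idGate j with N = n + j.  The constructor resp closes the set under
-- equality of gates.
data ⌈_⌉ {A : Set a} (P : Pred (B A) p) : Pred (B A) (a ⊔ p) where
  gen  : ∀ {b} → b ∈ P → b ∈ ⌈ P ⌉
  id₁  : (1 , idGate 1) ∈ ⌈ P ⌉
  comp : ∀ {n} {f g : Gate A n} → (n , f) ∈ ⌈ P ⌉ → (n , g) ∈ ⌈ P ⌉ →
         (n , f ∘ᵍ g) ∈ ⌈ P ⌉
  ext  : ∀ {n} {f : Gate A n} → (n , f) ∈ ⌈ P ⌉ →
         ∀ j (α : Permutation′ (n + j)) → (n + j , rewire α (f ⊕ idGate j)) ∈ ⌈ P ⌉
  resp : ∀ {n} {f g : Gate A n} → f ≈ g → (n , f) ∈ ⌈ P ⌉ → (n , g) ∈ ⌈ P ⌉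

module _ {A : Set a} (_≟_ : DecidableEquality A) where

  controlledMap : Vec A k → (Vec A ℓ → Vec A ℓ) → Vec A (k + ℓ) → Vec A (k + ℓ)
  controlledMap {k = k} w s x =
    let u = take k x
        v = drop k x
    in if does (≡-dec _≟_ u w) then u ++ s v else u ++ v

  controlledMap-++-≡ : ∀ (w : Vec A k) (s : Vec A ℓ → Vec A ℓ) v →
                       controlledMap w s (w ++ v) ≡ w ++ s v
  controlledMap-++-≡ w s v
    rewrite take-++ w v | drop-++ w v with ≡-dec _≟_ w w
  ... | yes _  = refl
  ... | no w≢w = contradiction refl w≢w

  controlledMap-++-≢ : ∀ {w : Vec A k} (s : Vec A ℓ → Vec A ℓ) {u} v → u ≢ w →
                       controlledMap w s (u ++ v) ≡ u ++ v
  controlledMap-++-≢ {w = w} s {u} v u≢w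
    rewrite take-++ u v | drop-++ u v with ≡-dec _≟_ u w
  ... | yes u≡w = contradiction u≡w u≢w
  ... | no _    = refl

  controlledMap-inverse : ∀ (w : Vec A k) (s s′ : Vec A ℓ → Vec A ℓ) →
    (∀ v → s (s′ v) ≡ v) → ∀ x → controlledMap w s (controlledMap w s′ x) ≡ x
  controlledMap-inverse {k = k} w s s′ ss′ x
    with ≡-dec _≟_ (take k x) w
  ... | yes refl = trans (controlledMap-++-≡ w s (s′ (drop k x)))
                         (trans (cong (w ++_) (ss′ (drop k x))) (take++drop≡id k x))
  ... | no u≢w   = trans (controlledMap-++-≢ s (drop k x) u≢w) (take++drop≡id k x)

  -- The gate f_{w,p}.
  controlled : Vec A k → Gate A ℓ → Gate A (k + ℓ)
  controlled w q = mk↔ₛ′ (controlledMap w Q.to) (controlledMap w Q.from)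
    (controlledMap-inverse w Q.to Q.from Q.strictlyInverseˡ)
    (controlledMap-inverse w Q.from Q.to Q.strictlyInverseʳ)
    where module Q = Inverse q

-- Finiteness of A enters only through the decidable equality it provides.
-- Membership is stated up to _≈_, so P itself need not respect _≈_.
CP : {A : Set a} → Finite A → ∀ k → Pred (Gate A ℓ) p → Pred (Gate A (k + ℓ)) (a ⊔ p)
CP {ℓ = ℓ} {A = A} fin k P f =
  Σ (Vec A k) λ w → Σ (Gate A ℓ) λ q → Σ (Permutation′ (k + ℓ)) λ α →
    q ∈ P × f ≈ rewire α (controlled (Finite⇒≟ fin) w q)

{-# OPTIONS --safe #-}

-- Prefixing one more control symbol a to a gate is compatible with composition,
-- extension and rewiring, and it turns a rewiring of f_{w,p} into a rewiring of
-- f_{aw,p}.  Hence a derivation of f_{w,p} (with w of length k + 1) from CP(k,P)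
-- becomes, line by line, a derivation of f_{aw,p} from CP(k+1,P), so the
-- hypothesis at k implies the one at k + 1.

module Submission where

open import Data.Fin.Permutation using (Permutation′; lift₀; flip) renaming (id to idₚ)
open import Data.Nat.Base using (ℕ; suc; _+_; _≥_; NonZero; _≤′_; ≤′-refl; ≤′-step)
open import Data.Nat.Properties using (+-identityʳ; ≤⇒≤′; ≤′⇒≤; ≤-trans)
open import Data.Product.Base using (_,_)
open import Data.Vec.Base using (Vec; []; _∷_; _++_; cast; take; drop)
open import Data.Vec.Properties
  using (≡-dec; cast-is-id; take++drop≡id; tabulate∘lookup; ∷-injectiveʳ; ++-identityʳ-eqFree)
open import Function.Bundles using (Inverse)
open import Relation.Binary.Definitions using (DecidableEquality)
open import Relation.Binary.PropositionalEquality
  using (_≡_; _≢_; refl; sym; trans; cong; subst; module ≡-Reasoning)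
open import Relation.Nullary using (yes; no)
open import Relation.Unary using (Pred; _⊆_; _∈_)
open import Defs

open Inverse using (to)

module _ {a} {A : Set a} where

  rewire-cong : ∀ {n} (α : Permutation′ n) {f g : Gate A n} → f ≈ g → rewire α f ≈ rewire α g
  rewire-cong α f≈g x = cong (permute α) (f≈g (permute (flip α) x))

  rewire-id : ∀ {n} (f : Gate A n) → f ≈ rewire idₚ f
  rewire-id f x = sym (trans (tabulate∘lookup _) (cong (to f) (tabulate∘lookup x)))

module _ {a p} {A : Set a} {P : Pred (B A) p} where

  ⌈⌉-least : ∀ {q} {Q : Pred (B A) q} → Q ⊆ ⌈ P ⌉ → ⌈ Q ⌉ ⊆ ⌈ P ⌉
  ⌈⌉-least h (gen b)      = h b
  ⌈⌉-least h id₁          = id₁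
  ⌈⌉-least h (comp d e)   = comp (⌈⌉-least h d) (⌈⌉-least h e)
  ⌈⌉-least h (ext d j α)  = ext (⌈⌉-least h d) j α
  ⌈⌉-least h (resp f≈g d) = resp f≈g (⌈⌉-least h d)

  -- `ext` only produces arities of the literal form `n + j`. Keeping `N` a variable lets `eq` be
  -- matched with `refl`, even where the intended equation does not hold by computation.
  ⌈⌉-ext-cast : ∀ {n j N} (eq : n + j ≡ N) (α : Permutation′ N) {f : Gate A n} {g : Gate A N} →
                (∀ x → cast eq (to (f ⊕ idGate j) x) ≡ to g (cast eq x)) →
                (n , f) ∈ ⌈ P ⌉ → (N , rewire α g) ∈ ⌈ P ⌉
  ⌈⌉-ext-cast {j = j} refl α {f} {g} h d = resp
    (rewire-cong α {f ⊕ idGate j} {g} λ x →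
      trans (sym (cast-is-id refl _)) (trans (h x) (cong (to g) (cast-is-id refl x))))
    (ext d j α)

  -- A rewiring is the extension by `j = 0` wires; the casts bridge `n + 0` and `n`.
  ⌈⌉-rewire : ∀ {n} {f : Gate A n} (α : Permutation′ n) →
              (n , f) ∈ ⌈ P ⌉ → (n , rewire α f) ∈ ⌈ P ⌉
  ⌈⌉-rewire {n} {f} α = ⌈⌉-ext-cast eq α {f} {f} λ x → begin
      cast eq (to f (take n x) ++ drop n x)  ≡⟨ cast-++[] (to f (take n x)) (drop n x) ⟩
      to f (take n x)                        ≡⟨ cong (to f) (cast-++[] (take n x) (drop n x)) ⟨
      to f (cast eq (take n x ++ drop n x))  ≡⟨ cong (λ y → to f (cast eq y)) (take++drop≡id n x) ⟩
      to f (cast eq x)                       ∎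
    where
    open ≡-Reasoning
    eq = +-identityʳ n
    cast-++[] : ∀ (u : Vec A n) (v : Vec A 0) → cast eq (u ++ v) ≡ u
    cast-++[] u [] = ++-identityʳ-eqFree u

module _ {a} {A : Set a} where

  -- `g` acts as the gate controlled by the single symbol `c`. A relation is used because the same
  -- gate arises in several forms: from a longer control word, as a composite, as an extension or as
  -- a rewiring.
  record Controls (c : A) {n} (f : Gate A n) (g : Gate A (suc n)) : Set a where
    field
      on  : ∀ x → to g (c ∷ x) ≡ c ∷ to f x
      off : ∀ {b} → b ≢ c → ∀ x → to g (b ∷ x) ≡ b ∷ x

  open Controls

  module _ {c : A} {n : ℕ} where

    Controls-respˡ : ∀ {f f′ : Gate A n} {g} → f ≈ f′ → Controls c f g → Controls c f′ g
    Controls-respˡ f≈f′ C .on x = trans (on C x) (cong (c ∷_) (f≈f′ x))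
    Controls-respˡ f≈f′ C .off  = off C

    Controls-id : Controls c (idGate n) (idGate (suc n))
    Controls-id .on _    = refl
    Controls-id .off _ _ = refl

    Controls-∘ : ∀ {f f′ : Gate A n} {g g′} →
                 Controls c f g → Controls c f′ g′ → Controls c (f ∘ᵍ f′) (g ∘ᵍ g′)
    Controls-∘ {f′ = f′} {g} C C′ .on x = trans (cong (to g) (on C′ x)) (on C (to f′ x))
    Controls-∘ {g = g} C C′ .off b≢c x  = trans (cong (to g) (off C′ b≢c x)) (off C b≢c x)

    Controls-⊕ : ∀ {f : Gate A n} {g} j → Controls c f g →
                 Controls c (f ⊕ idGate j) (g ⊕ idGate j)
    Controls-⊕ j C .on x      = cong (_++ drop n x) (on C (take n x))
    Controls-⊕ j C .off b≢c x =
      trans (cong (_++ drop n x) (off C b≢c (take n x))) (cong (_ ∷_) (take++drop≡id n x))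

    -- `lift₀ α` fixes the new wire 0, so `permute (lift₀ α)` computes past the leading symbol; when
    -- `f` is switched off, the two wire permutations cancel.
    Controls-rewire : ∀ {f : Gate A n} {g} α → Controls c f g →
                      Controls c (rewire α f) (rewire (lift₀ α) g)
    Controls-rewire α C .on x = cong (permute (lift₀ α)) (on C (permute (flip α) x))
    Controls-rewire α C .off {b} b≢c x = trans
      (cong (permute (lift₀ α)) (off C b≢c (permute (flip α) x)))
      (cong (b ∷_) (Inverse.strictlyInverseˡ (wire α) x))

  module _ (_≟_ : DecidableEquality A) where

    -- The leading symbol decides which clause determines the output. Through `resp`, a derivation
    -- of one controlled version of `f` thus serves for every other.
    Controls-unique : ∀ {c n} {f : Gate A n} {g h} → Controls c f g → Controls c f h → g ≈ h
    Controls-unique {c} C D (b ∷ x) with b ≟ c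
    ... | yes refl = trans (on C x) (sym (on D x))
    ... | no b≢c   = trans (off C b≢c x) (sym (off D b≢c x))

    Controls-controlled₁ : ∀ {c n} (f : Gate A n) → Controls c f (controlled _≟_ (c ∷ []) f)
    Controls-controlled₁ {c} f .on = controlledMap-++-≡ _≟_ (c ∷ []) (to f)
    Controls-controlled₁ {c} f .off b≢c x =
      controlledMap-++-≢ _≟_ {w = c ∷ []} (to f) x λ { refl → b≢c refl }

    Controls-controlled : ∀ {c k ℓ} (w : Vec A k) (q : Gate A ℓ) →
                          Controls c (controlled _≟_ w q) (controlled _≟_ (c ∷ w) q)
    Controls-controlled {c} {k} w q .on x =
      -- `x` is not syntactically an append, so it is replaced by `take k x ++ drop k x`, on which
      -- the equations for `controlledMap` apply.
      subst (λ y → controlledMap _≟_ (c ∷ w) (to q) (c ∷ y) ≡ c ∷ controlledMap _≟_ w (to q) y)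
        (take++drop≡id k x) (on-++ (take k x) (drop k x))
      where
      on-++ : ∀ u v → controlledMap _≟_ (c ∷ w) (to q) (c ∷ u ++ v) ≡
                      c ∷ controlledMap _≟_ w (to q) (u ++ v)
      on-++ u v with ≡-dec _≟_ u w
      ... | yes refl = trans (controlledMap-++-≡ _≟_ (c ∷ w) (to q) v)
                             (cong (c ∷_) (sym (controlledMap-++-≡ _≟_ w (to q) v)))
      ... | no u≢w   = trans (controlledMap-++-≢ _≟_ (to q) v λ eq → u≢w (∷-injectiveʳ eq))
                             (cong (c ∷_) (sym (controlledMap-++-≢ _≟_ (to q) v u≢w)))
    Controls-controlled {c} {k} w q .off {b} b≢c x =
      subst (λ y → controlledMap _≟_ (c ∷ w) (to q) (b ∷ y) ≡ b ∷ y) (take++drop≡id k x)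
        (controlledMap-++-≢ _≟_ {w = c ∷ w} (to q) (drop k x) λ { refl → b≢c refl })

module _ {a p} {A : Set a} (fin : Finite A) {ℓ : ℕ} {P : Pred (Gate A ℓ) p} where

  private _≟_ = Finite⇒≟ fin

  -- Induction on the derivation of `f`, with `g` arbitrary. Intermediate gates need not have the
  -- form f_{w,p}, so `Controls-controlled₁` supplies their controlled versions.
  ⌈CP⌉-control : ∀ {c k n} {f : Gate A n} {g} → Controls c f g →
                 (n , f) ∈ ⌈ inB (CP fin k P) ⌉ → (suc n , g) ∈ ⌈ inB (CP fin (suc k) P) ⌉
  ⌈CP⌉-control {c} C (gen (gate (w , q , α , q∈P , f≈))) =
    gen (gate (c ∷ w , q , lift₀ α , q∈P ,
      Controls-unique _≟_ (Controls-respˡ f≈ C) (Controls-rewire α (Controls-controlled _≟_ w q))))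
  ⌈CP⌉-control C id₁ =
    -- The controlled identity of one wire is the identity of two wires, an extension of `id₁`.
    resp (λ x → trans (sym (rewire-id (idGate 1 ⊕ idGate 1) x))
                      (trans (take++drop≡id 1 x) (Controls-unique _≟_ Controls-id C x)))
         (ext id₁ 1 idₚ)
  ⌈CP⌉-control C (comp {f = f} {g} d e) =
    resp (Controls-unique _≟_ (Controls-∘ Cf Cg) C) (comp (⌈CP⌉-control Cf d) (⌈CP⌉-control Cg e))
    where
    Cf = Controls-controlled₁ _≟_ f
    Cg = Controls-controlled₁ _≟_ g
  ⌈CP⌉-control C (ext {f = f} d j α) =
    resp (Controls-unique _≟_ (Controls-rewire α (Controls-⊕ j Cf)) C)
      (ext (⌈CP⌉-control Cf d) j (lift₀ α))
    where Cf = Controls-controlled₁ _≟_ f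
  ⌈CP⌉-control C (resp {f = f} f≈g d) =
    ⌈CP⌉-control (Controls-respˡ (λ x → sym (f≈g x)) C) d

  CP-suc : ∀ {k} → inB (CP fin (suc k) P) ⊆ ⌈ inB (CP fin k P) ⌉ →
           inB (CP fin (suc (suc k)) P) ⊆ ⌈ inB (CP fin (suc k) P) ⌉
  CP-suc h (gate (c ∷ w , q , α , q∈P , f≈)) =
    -- `α` may move the wire of `c`, so it need not be of the form `lift₀ β`. Hence `h` is applied
    -- to the unrewired gate for `w`, and `α` only after the control `c` has been added.
    resp (λ x → sym (f≈ x)) (⌈⌉-rewire α
      (⌈CP⌉-control (Controls-controlled _≟_ w q)
        (h (gate (w , q , idₚ , q∈P , rewire-id (controlled _≟_ w q))))))

  CP-step : ∀ {k n} → inB (CP fin (suc k) P) ⊆ ⌈ inB (CP fin k P) ⌉ → k ≤′ n →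
            inB (CP fin (suc n) P) ⊆ ⌈ inB (CP fin n P) ⌉
  CP-step h ≤′-refl       = h
  CP-step h (≤′-step k≤n) = CP-suc (CP-step h k≤n)

  ⌈CP⌉-antitone : ∀ {k m n} → inB (CP fin (suc k) P) ⊆ ⌈ inB (CP fin k P) ⌉ → k ≤′ n → n ≤′ m →
                  ⌈ inB (CP fin m P) ⌉ ⊆ ⌈ inB (CP fin n P) ⌉
  ⌈CP⌉-antitone h k≤n ≤′-refl       d = d
  ⌈CP⌉-antitone h k≤n (≤′-step n≤m) d =
    ⌈CP⌉-antitone h k≤n n≤m
      -- Here the outer arity index is a successor; `CP-step` applies at its predecessor, which is
      -- still at least `n` and so at least `k`.
      (⌈⌉-least (CP-step h (≤⇒≤′ (≤-trans (≤′⇒≤ k≤n) (≤′⇒≤ n≤m)))) d)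

lemma2 : ∀ {a p} {A : Set a} (fin : Finite A) (ℓ : ℕ) .{{_ : NonZero ℓ}}
    (P : Pred (Gate A ℓ) p) (k : ℕ) →
    inB (CP fin (suc k) P) ⊆ ⌈ inB (CP fin k P) ⌉ →
    ∀ m n → m ≥ n → n ≥ k →
    ⌈ inB (CP fin m P) ⌉ ⊆ ⌈ inB (CP fin n P) ⌉
lemma2 fin ℓ P k h m n m≥n n≥k = ⌈CP⌉-antitone fin h (≤⇒≤′ n≥k) (≤⇒≤′ m≥n)
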